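{- Every satisfiable OBFOL sentence over $\Sigma(\mathrm{Var})$ has a finite model.
   Context: Language signature $\Sigma=(\mathrm{Args},\mathrm{Rels},\mathrm{ar})$: $\mathrm{Args},\mathrm{Rels}$ finite non-empty, $\mathrm{ar}:\mathrm{Rels}\to\mathcal P(\mathrm{Args})\setminus\{\emptyset\}$. A $\Sigma$-structure $\mathcal R=(D,\cdot^{\mathcal R})$: $D$ non-empty, $r^{\mathcal R}$ a set of functions $\mathrm{ar}(r)\to D$; finite iff $D$ finite. FOL formulas over $\Sigma(\mathrm{Var})$: $\varphi::= r\mid\neg\varphi\mid\varphi\wedge\varphi\mid\varphi\vee\varphi\mid\exists x.\varphi\mid\forall x.\varphi\mid(a,x)\varphi$. Free placeholders: $\mathrm{free}(r)=\mathrm{ar}(r)$; unchanged by $\neg$; union for $\wedge,\vee$; $\mathrm{free}(Qx.\varphi)=\mathrm{free}(\varphi)\setminus\{x\}$; $\mathrm{free}((a,x)\varphi)=(\mathrm{free}(\varphi)\setminus\{a\})\cup\{x\}$ if $a\in\mathrm{free}(\varphi)$, else $\mathrm{free}(\varphi)$; a sentence has none. Semantics over partial assignments $\chi:\mathrm{Args}\cup\mathrm{Var}\rightharpoonup D$: $\mathcal R,\chi\models r$ iff $\chi|_{\mathrm{ar}(r)}\in r^{\mathcal R}$; usual Boolean/quantifier clauses; $\mathcal R,\chi\models(a,x)\varphi$ iff $\mathcal R,\chi[a\mapsto\chi(x)]\models\varphi$. A model of a sentence $\varphi$ is $\mathcal R$ with $\mathcal R,\emptyset\models\varphi$; satisfiable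 means having a model. Quantification prefix: finite word over $\{\exists x,\forall x\}$, each variable at most once; binding prefix: finite word over pairs $(a,x)$, each argument at most once; derived relation: Boolean combination ($\neg,\wedge,\vee$) of relations all having the same argument set. OBFOL formulas: $\varphi::=\wp\flat\bar r\mid(\varphi\wedge\varphi)\mid(\varphi\vee\varphi)$, $\wp$ a quantification prefix, $\flat$ a binding prefix, $\bar r$ a derived relation. -}

module Defs where

open import Data.Nat as ℕ using (ℕ; suc)
open import Data.Fin as Fin using (Fin)
open import Data.Fin.Subset using (Subset; _∈_; Nonempty)
open import Data.Fin.Subset.Properties using (_∈?_)
open import Data.Bool using (Bool; true; false; _∧_; _∨_; not; if_then_else_)
open import Data.Maybe using (Maybe; just; nothing)
open import Data.List using (List; []; _∷_; map)
open import Data.List.Relation.Unary.Unique.Propositional using (Unique)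
open import Data.Product using (Σ; ∃; _×_; _,_; proj₁; proj₂)
open import Data.Sum using (_⊎_)
open import Data.Empty using (⊥)
open import Relation.Nullary using (¬_; Dec; yes; no)
open import Relation.Nullary.Decidable using (⌊_⌋)
open import Relation.Binary.PropositionalEquality using (_≡_)
open import Function.Bundles using (_↔_)

-- Language signatures.  Args and Rels are finite non-empty sets,
-- represented (up to renaming) as Fin (suc nArgs) and Fin (suc nRels).
-- ar(r) is a non-empty subset of Args.

record Signature : Set where
  field
    nArgs  : ℕ
    nRels  : ℕ
  Args : Set
  Args = Fin (suc nArgs)
  Rels : Set
  Rels = Fin (suc nRels)
  field
    ar          : Rels → Subset (suc nArgs)
    ar-nonempty : ∀ r → Nonempty (ar r)

-- Variables: a countably infinite set, disjoint from Args.
Var : Set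
Var = ℕ

module _ (S : Signature) where
  open Signature S

  -- Σ-structures.  A function ar(r) → D is represented by a total
  -- function Args → D of which only the values on ar(r) matter; r^R is
  -- a predicate on such functions that depends only on the values on
  -- ar(r) (field rel-resp), i.e. exactly a set of functions ar(r) → D.

  record Structure : Set₁ where
    field
      D        : Set
      D-inhab  : D
      rel      : Rels → (Args → D) → Set
      rel-resp : ∀ r (f g : Args → D) →
                 (∀ a → a ∈ ar r → f a ≡ g a) → rel r f → rel r g

  Finite : Structure → Set
  Finite R = ∃ λ n → Structure.D R ↔ Fin n

  data Formula : Set where
    rel  : Rels → Formula
    neg  : Formula → Formula
    and  : Formula → Formula → Formula
    or   : Formula → Formula → Formula
    ex   : Var → Formula → Formula
    all  : Var → Formula → Formula
    bind : Args → Var → Formula → Formula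

  freeArg : Formula → Args → Bool
  freeVar : Formula → Var → Bool
  freeArg (rel r)      b = ⌊ b ∈? ar r ⌋
  freeArg (neg φ)      b = freeArg φ b
  freeArg (and φ ψ)    b = freeArg φ b ∨ freeArg ψ b
  freeArg (or φ ψ)     b = freeArg φ b ∨ freeArg ψ b
  freeArg (ex x φ)     b = freeArg φ b
  freeArg (all x φ)    b = freeArg φ b
  freeArg (bind a x φ) b =
    if freeArg φ a then freeArg φ b ∧ not ⌊ b Fin.≟ a ⌋ else freeArg φ b
  freeVar (rel r)      y = false
  freeVar (neg φ)      y = freeVar φ y
  freeVar (and φ ψ)    y = freeVar φ y ∨ freeVar ψ y
  freeVar (or φ ψ)     y = freeVar φ y ∨ freeVar ψ y
  freeVar (ex x φ)     y = freeVar φ y ∧ not ⌊ y ℕ.≟ x ⌋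
  freeVar (all x φ)    y = freeVar φ y ∧ not ⌊ y ℕ.≟ x ⌋
  freeVar (bind a x φ) y =
    if freeArg φ a then freeVar φ y ∨ ⌊ y ℕ.≟ x ⌋ else freeVar φ y

  Sentence : Formula → Set
  Sentence φ = (∀ a → freeArg φ a ≡ false) × (∀ x → freeVar φ x ≡ false)

  record Assignment (D : Set) : Set where
    constructor ⟨_,_⟩
    field
      onArgs : Args → Maybe D
      onVars : Var → Maybe D

  emptyAssignment : ∀ {D} → Assignment D
  emptyAssignment = ⟨ (λ _ → nothing) , (λ _ → nothing) ⟩

  setVar : ∀ {D} → Assignment D → Var → D → Assignment D
  setVar ⟨ α , β ⟩ x d = ⟨ α , (λ y → if ⌊ y ℕ.≟ x ⌋ then just d else β y) ⟩

  -- χ[a ↦ χ(x)]  (a becomes undefined if χ(x) is)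
  setArg : ∀ {D} → Assignment D → Args → Var → Assignment D
  setArg ⟨ α , β ⟩ a x = ⟨ (λ b → if ⌊ b Fin.≟ a ⌋ then β x else α b) , β ⟩

  infix 4 _,_⊨_
  _,_⊨_ : (R : Structure) → Assignment (Structure.D R) → Formula → Set
  R , χ ⊨ rel r      = ∃ λ (f : Args → Structure.D R) →
                         (∀ a → a ∈ ar r → Assignment.onArgs χ a ≡ just (f a))
                         × Structure.rel R r f
  R , χ ⊨ neg φ      = ¬ (R , χ ⊨ φ)
  R , χ ⊨ and φ ψ    = (R , χ ⊨ φ) × (R , χ ⊨ ψ)
  R , χ ⊨ or φ ψ     = (R , χ ⊨ φ) ⊎ (R , χ ⊨ ψ)
  R , χ ⊨ ex x φ     = Σ (Structure.D R) λ d → R , setVar χ x d ⊨ φ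
  R , χ ⊨ all x φ    = (d : Structure.D R) → R , setVar χ x d ⊨ φ
  R , χ ⊨ bind a x φ = R , setArg χ a x ⊨ φ

  IsModel : Structure → Formula → Set
  IsModel R φ = R , emptyAssignment ⊨ φ

  Satisfiable : Formula → Set₁
  Satisfiable φ = ∃ λ R → IsModel R φ

  HasFiniteModel : Formula → Set₁
  HasFiniteModel φ = ∃ λ R → Finite R × IsModel R φ

  data Quant : Set where
    ∃q ∀q : Quant

  QPrefix : Set
  QPrefix = Σ (List (Quant × Var)) λ w → Unique (map proj₂ w)

  BPrefix : Set
  BPrefix = Σ (List (Args × Var)) λ w → Unique (map proj₁ w)

  data DerivedRel (A : Subset (suc nArgs)) : Set where
    atom : (r : Rels) → ar r ≡ A → DerivedRel A
    dneg : DerivedRel A → DerivedRel A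
    dand : DerivedRel A → DerivedRel A → DerivedRel A
    dor  : DerivedRel A → DerivedRel A → DerivedRel A

  data OBFOL : Set where
    basic : QPrefix → BPrefix → (A : Subset (suc nArgs)) → DerivedRel A → OBFOL
    oand  : OBFOL → OBFOL → OBFOL
    oor   : OBFOL → OBFOL → OBFOL

  derived⇒F : ∀ {A} → DerivedRel A → Formula
  derived⇒F (atom r _) = rel r
  derived⇒F (dneg d)   = neg (derived⇒F d)
  derived⇒F (dand d e) = and (derived⇒F d) (derived⇒F e)
  derived⇒F (dor d e)  = or (derived⇒F d) (derived⇒F e)

  applyQ : List (Quant × Var) → Formula → Formula
  applyQ []              φ = φ
  applyQ ((∃q , x) ∷ w) φ = ex x (applyQ w φ)
  applyQ ((∀q , x) ∷ w) φ = all x (applyQ w φ)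

  applyB : List (Args × Var) → Formula → Formula
  applyB []            φ = φ
  applyB ((a , x) ∷ w) φ = bind a x (applyB w φ)

  toFormula : OBFOL → Formula
  toFormula (basic q b A d) = applyQ (proj₁ q) (applyB (proj₁ b) (derived⇒F d))
  toFormula (oand φ ψ)      = and (toFormula φ) (toFormula ψ)
  toFormula (oor φ ψ)       = or (toFormula φ) (toFormula ψ)

{-# OPTIONS --safe #-}
-- A true conjunct ℘♭r̄ has a Skolem strategy winning in the given structure R.
-- In the finite model the existential players use instead the operations of a
-- finite algebra that looks free in the following sense: if one argument vector is
-- fixed for each operation, then every assignment of operations on an arbitrary
-- set X to the symbols admits a map h into X commuting with these particular
-- applications.  An atom holds at a tuple of the finite model iff it holds in R
-- at the image of the tuple under h, where the fixed argument vectors come from one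
-- play realizing the tuple for each conjunct; then h carries these plays to
-- winning plays in R, so that all conjuncts realizing the tuple hold there at once.
-- This uses that every conjunct sees a single tuple, its binding prefix being
-- applied to the whole derived relation.
module Submission where

open import Defs
open import Level using (0ℓ)
open import Axiom.ExcludedMiddle using (ExcludedMiddle)
open import Data.Bool using (Bool; true; false; _∧_; _∨_; not; if_then_else_)
open import Data.Bool.Properties using (∧-identityʳ; ∨-zeroʳ)
open import Data.Empty using (⊥)
open import Data.Fin as Fin using (Fin; zero; suc; toℕ)
import Data.Fin.Properties as Finₚ
open import Data.Fin.Subset as Subset using (Subset)
open import Data.Fin.Subset.Properties using (_∈?_)
open import Data.List as List using (List; []; _∷_; _++_; length; concatMap)
open import Data.List.Membership.Propositional using (_∈_; _∉_)
open import Data.List.Membership.Propositional.Properties using (∈-concatMap⁺)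
import Data.List.Membership.DecPropositional as DecMembership
import Data.List.Properties as Listₚ
open import Data.List.Relation.Unary.All using (All; []; _∷_)
open import Data.List.Relation.Unary.All.Properties using (++⁻ˡ; ++⁻ʳ; tabulate⁺)
open import Data.List.Relation.Unary.Any as Any using (here; there)
open import Data.List.Relation.Unary.Any.Properties using (lookup-index)
open import Data.Maybe using (Maybe; just)
open import Data.Maybe.Properties using (just-injective)
open import Data.Nat as ℕ using (ℕ; zero; suc; _+_; _*_; _⊔_; _≤_; _<_; z≤n; s≤s; s≤s⁻¹)
open import Data.Nat.DivMod using (_mod_; m<n⇒m%n≡m)
import Data.Nat.Properties as ℕₚ
open import Data.Product using (Σ; ∃; _×_; _,_; proj₁; proj₂)
open import Data.Product.Function.NonDependent.Propositional using (_×-↔_; _×-⇔_)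
open import Data.Sum using (_⊎_; inj₁; inj₂)
open import Data.Sum.Function.Propositional using (_⊎-⇔_)
open import Data.Unit using (⊤; tt)
open import Data.Vec as Vec using (Vec; []; _∷_; toList)
import Data.Vec.Properties as Vecₚ
open import Function using (_∘_)
open import Function.Bundles using (_↔_; mk↔ₛ′; _⇔_; mk⇔; Equivalence)
open import Function.Construct.Composition using (_↔-∘_)
open import Function.Construct.Symmetry using (↔-sym)
open import Function.Properties.Inverse using (↔⇒↣)
open import Function.Related.TypeIsomorphisms using (¬-cong-⇔)
open import Relation.Binary.Definitions using (DecidableEquality)
open import Relation.Binary.PropositionalEquality
open import Relation.Nullary using (¬_; Dec; yes; no; contradiction)
open import Relation.Nullary.Decidable using (via-injection; ⌊_⌋)

-- Pigeonhole and length estimates for lists.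

fresh : ∀ {n} (cs : List (Fin n)) → length cs < n → ∃ λ c → c ∉ cs
fresh {n} cs short = Finₚ.¬∀⟶∃¬ n (_∈ cs) (_∈?ₗ cs) λ everywhere →
  let i , j , i<j , eq = Finₚ.pigeonhole short (Any.index ∘ everywhere)
  in Finₚ.<⇒≢ i<j (trans (lookup-index (everywhere i))
       (trans (cong (List.lookup cs) eq) (sym (lookup-index (everywhere j)))))
  where open DecMembership Finₚ._≟_ using () renaming (_∈?_ to _∈?ₗ_)

length-concatMap-≤ : ∀ {A B : Set} (f : A → List B) b → (∀ x → length (f x) ≤ b) →
                     ∀ xs → length (concatMap f xs) ≤ length xs * b
length-concatMap-≤ f b f≤b []       = z≤n
length-concatMap-≤ f b f≤b (x ∷ xs) =
  subst (_≤ b + length xs * b) (sym (Listₚ.length-++ (f x)))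
    (ℕₚ.+-mono-≤ (f≤b x) (length-concatMap-≤ f b f≤b xs))

-- Finite algebras without short cycles

-- Terms over T symbols of arity K, cut off at depth suc T.  Nodes carry a symbol
-- (zero is reserved for the constant star) and a colour; a node made by mk has a
-- colour absent from the top T levels of its arguments, so that no term recurs
-- within T steps down a chain of applications of mk.
module Terms (T K : ℕ) where

  -- The number of nodes in the top `d` levels of a `K`-ary tree. The palette of `size (suc T)`
  -- colours exceeds by one the bound `K * size T` on those that a fresh colour must avoid.
  size : ℕ → ℕ
  size zero    = 0
  size (suc d) = suc (K * size d)

  Label : Set
  Label = Fin (suc T) × Fin (size (suc T))

  Tree : ℕ → Set
  Tree zero    = ⊤
  Tree (suc n) = Label × Vec (Tree n) K

  Term : Set
  Term = Tree (suc T)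

  Vec-finite : ∀ {A : Set} {m} → A ↔ Fin m → ∀ k → ∃ λ n → Vec A k ↔ Fin n
  Vec-finite A↔m zero    =
    1 , mk↔ₛ′ (λ _ → zero) (λ _ → []) (λ { zero → refl }) (λ { [] → refl })
  Vec-finite A↔m (suc k) =
    let n , v↔n = Vec-finite A↔m k
    in _ , ↔-sym Finₚ.*↔× ↔-∘ ((A↔m ×-↔ v↔n) ↔-∘
         mk↔ₛ′ Vec.uncons (λ { (x , xs) → x ∷ xs }) (λ _ → refl) (λ { (x ∷ xs) → refl }))

  Tree-finite : ∀ n → ∃ λ m → Tree n ↔ Fin m
  Tree-finite zero    = 1 , mk↔ₛ′ (λ _ → zero) (λ _ → tt) (λ { zero → refl }) (λ _ → refl)
  Tree-finite (suc n) =
    let m , vec↔m = Vec-finite (proj₂ (Tree-finite n)) K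
    in _ , ↔-sym Finₚ.*↔× ↔-∘ (↔-sym Finₚ.*↔× ×-↔ vec↔m)

  -- Abstract, like freshColour below: unfolding them makes `with` very slow.
  abstract
    _≟_ : DecidableEquality Term
    _≟_ = via-injection (↔⇒↣ (proj₂ (Tree-finite (suc T)))) Finₚ._≟_

  truncate : ∀ {n} → Tree (suc n) → Tree n
  truncate {zero}  _        = tt
  truncate {suc n} (l , ts) = l , Vec.map truncate ts

  -- The colours in the top d levels.
  colours : ℕ → ∀ {n} → Tree n → List (Fin (size (suc T)))
  colours zero            _              = []
  colours (suc d) {zero}  _              = []
  colours (suc d) {suc n} ((_ , c) , ts) = c ∷ concatMap (colours d) (toList ts)

  length-colours : ∀ d {n} (t : Tree n) → length (colours d t) ≤ size d
  length-colours* : ∀ d {n} (ts : Vec (Tree n) K) →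
                    length (concatMap (colours d) (toList ts)) ≤ K * size d

  length-colours zero            t        = z≤n
  length-colours (suc d) {zero}  t        = z≤n
  length-colours (suc d) {suc n} (_ , ts) = s≤s (length-colours* d ts)

  length-colours* d ts =
    subst (λ k → length (concatMap (colours d) (toList ts)) ≤ k * size d)
      (Vecₚ.length-toList ts)
      (length-concatMap-≤ (colours d) (size d) (length-colours d) (toList ts))

  -- Truncation drops only the deepest level, which lies below the top `d`.
  colours-truncate : ∀ {d n} → d ≤ n → (t : Tree (suc n)) →
                     colours d (truncate t) ≡ colours d t
  colours-truncate* : ∀ {d n k} → d ≤ n → (ts : Vec (Tree (suc n)) k) →
                      concatMap (colours d) (toList (Vec.map truncate ts)) ≡
                      concatMap (colours d) (toList ts)

  colours-truncate z≤n       t              = refl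
  colours-truncate (s≤s d≤n) ((_ , c) , ts) = cong (c ∷_) (colours-truncate* d≤n ts)

  colours-truncate* d≤n []       = refl
  colours-truncate* d≤n (t ∷ ts) =
    cong₂ _++_ (colours-truncate d≤n t) (colours-truncate* d≤n ts)

  blank : ∀ n → Tree n
  blank zero    = tt
  blank (suc n) = (zero , zero) , Vec.replicate K (blank n)

  star : Term
  star = blank (suc T)

  abstract
    freshColour : (ws : Vec Term K) → ∃ λ c → c ∉ concatMap (colours T) (toList ws)
    freshColour ws = fresh _ (s≤s (length-colours* T ws))

  mk : Fin T → Vec Term K → Term
  mk t ws = (suc t , proj₁ (freshColour ws)) , Vec.map truncate ws

  colour : Term → Fin (size (suc T))
  colour ((_ , c) , _) = c

  ∈-colours* : ∀ {d n c} {w : Tree n} {ws : List (Tree n)} → w ∈ ws →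
               c ∈ colours d w → c ∈ concatMap (colours d) ws
  ∈-colours* {d} w∈ws c∈w = ∈-concatMap⁺ (colours d) (Any.map (λ { refl → c∈w }) w∈ws)

  colours-child : ∀ {d} → d ≤ T → ∀ {c w} t ws → w ∈ toList ws →
                  c ∈ colours d w → c ∈ colours (suc d) (mk t ws)
  colours-child d≤T t ws w∈ws c∈w =
    there (subst (_ ∈_) (sym (colours-truncate* d≤T ws)) (∈-colours* w∈ws c∈w))

  -- Chains of applications and evaluation along them.

  module _ (hist : Fin T → Vec Term K) where

    val : Fin T → Term
    val t = mk t (hist t)

    Path : ℕ → Fin T → Set
    Path zero    t = ⊤
    Path (suc n) t = Σ (Fin T) λ u → val u ∈ toList (hist t) × Path n u

    vertex : ∀ {n t} → Path n t → ℕ → Fin T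
    vertex {zero}  {t} _           _       = t
    vertex {suc n} {t} _           zero    = t
    vertex {suc n}     (_ , _ , p) (suc k) = vertex p k

    -- Each `mk` pushes its arguments one level down, so `k` steps along the path the colour lies
    -- within the top `k + 1` levels, which truncation has not yet removed.
    colour-vertex : ∀ {n t} (p : Path n t) k {d} → k < d → d ≤ suc T →
                    colour (val (vertex p k)) ∈ colours d (val t)
    colour-vertex {zero}      _             k       (s≤s _)   _         = here refl
    colour-vertex {suc n}     _             zero    (s≤s _)   _         = here refl
    colour-vertex {suc n} {t} (u , u∈ , p)  (suc k) (s≤s k<d) (s≤s d≤T) =
      colours-child d≤T t (hist t) u∈ (colour-vertex p k k<d (ℕₚ.m≤n⇒m≤1+n d≤T))

    -- The colour of vertex `j` shows in the top `T` levels of the arguments of vertex `i`, exactly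
    -- where `mk` made the colour of vertex `i` absent.
    vertex-distinct : ∀ {n t} (p : Path n t) {i j} → i < j → j ≤ n → j ≤ T →
                      vertex p i ≢ vertex p j
    vertex-distinct {suc n} {t} (u , u∈ , p) {zero} {suc j} _ _ j<T t≡v =
      proj₂ (freshColour (hist t))
        (subst (λ v → colour (val v) ∈ concatMap (colours T) (toList (hist t))) (sym t≡v)
          (∈-colours* u∈ (colour-vertex p j j<T (ℕₚ.n≤1+n T))))
    vertex-distinct {suc n} (u , u∈ , p) {suc i} {suc j} (s≤s i<j) (s≤s j≤n) j<T =
      vertex-distinct p i<j j≤n (ℕₚ.<⇒≤ j<T)

    no-long-path : ∀ t → ¬ Path T t
    no-long-path t p =
      let i , j , i<j , eq = Finₚ.pigeonhole (ℕₚ.n<1+n T) (vertex p ∘ toℕ)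
          j≤T = s≤s⁻¹ (Finₚ.toℕ<n j)
      in vertex-distinct p i<j j≤T j≤T eq

    -- val t is determined by t, so by the pigeonhole principle a chain of T steps
    -- contains a short cycle; hence T rounds of evaluation reach a fixed point.
    module _ {X : Set} (x₀ : X) (g : Fin T → Vec X K → X) where

      eval : ℕ → Term → X
      eval zero    v                    = x₀
      eval (suc n) ((zero , _) , _)     = x₀
      -- The root symbol leaves `val t` as the only candidate, so one comparison decides.
      eval (suc n) v@((suc t , _) , _) with v ≟ val t
      ... | yes _ = g t (Vec.map (eval n) (hist t))
      ... | no  _ = x₀

      eval-val : ∀ n t → eval (suc n) (val t) ≡ g t (Vec.map (eval n) (hist t))
      eval-val n t with val t ≟ val t
      ... | yes _ = refl
      ... | no ¬p = contradiction refl ¬p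

      eval-other : ∀ n v → (∀ t → v ≢ val t) → eval n v ≡ x₀
      eval-other zero    v                    _     = refl
      eval-other (suc n) ((zero , _) , _)     _     = refl
      eval-other (suc n) v@((suc t , _) , _)  other with v ≟ val t
      ... | yes p = contradiction p (other t)
      ... | no  _ = refl

      -- An argument `val u` of `val t` starts only paths shorter by one; any other argument has
      -- value `x₀` at every depth of recursion.
      eval-stable : ∀ n t → ¬ Path n t → eval (suc n) (val t) ≡ eval n (val t)
      eval-stable zero    t ¬p = contradiction tt ¬p
      eval-stable (suc n) t ¬p = begin
        eval (suc (suc n)) (val t)            ≡⟨ eval-val (suc n) t ⟩
        g t (Vec.map (eval (suc n)) (hist t)) ≡⟨ cong (g t) (map-cong-∈ (hist t) step) ⟩
        g t (Vec.map (eval n) (hist t))       ≡⟨ eval-val n t ⟨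
        eval (suc n) (val t)                  ∎
        where
        open ≡-Reasoning
        map-cong-∈ : ∀ {k} (ws : Vec Term k) →
                     (∀ w → w ∈ toList ws → eval (suc n) w ≡ eval n w) →
                     Vec.map (eval (suc n)) ws ≡ Vec.map (eval n) ws
        map-cong-∈ []       eq = refl
        map-cong-∈ (w ∷ ws) eq =
          cong₂ _∷_ (eq w (here refl)) (map-cong-∈ ws λ v → eq v ∘ there)
        step : ∀ w → w ∈ toList (hist t) → eval (suc n) w ≡ eval n w
        step w w∈ with Finₚ.any? (λ u → w ≟ val u)
        ... | yes (u , refl) = eval-stable n u λ p → ¬p (u , w∈ , p)
        ... | no  none       =
          let other = λ u eq → none (u , eq)
          in trans (eval-other (suc n) w other) (sym (eval-other n w other))

      solution : ∃ λ (h : Term → X) → h star ≡ x₀ ×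
                 (∀ t → h (mk t (hist t)) ≡ g t (Vec.map h (hist t)))
      -- `star` carries the reserved symbol `zero`, so it is no `val t`.
      solution = eval T , eval-other T star (λ _ ()) ,
        λ t → trans (sym (eval-stable T t (no-long-path t))) (eval-val T t)

-- Updates, padding and bounds.

update : ∀ {I X : Set} → DecidableEquality I → (I → X) → I → X → I → X
update _≟_ f i x j = if ⌊ j ≟ i ⌋ then x else f j

pad : ∀ {X : Set} k → X → List X → Vec X k
pad zero    x₀ xs       = []
pad (suc k) x₀ []       = x₀ ∷ pad k x₀ []
pad (suc k) x₀ (x ∷ xs) = x ∷ pad k x₀ xs

take-pad : ∀ {X : Set} k x₀ (xs : List X) → length xs ≤ k →
           List.take (length xs) (toList (pad k x₀ xs)) ≡ xs
take-pad k       x₀ []       _         = refl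
take-pad (suc k) x₀ (x ∷ xs) (s≤s len) = cong (x ∷_) (take-pad k x₀ xs len)

bounded : ∀ {m} (f : Fin m → ℕ) → ∃ λ k → ∀ i → f i ≤ k
bounded {zero}  f = 0 , λ ()
bounded {suc m} f =
  let k , f≤k = bounded (f ∘ suc)
  in f zero ⊔ k , λ { zero    → ℕₚ.m≤m⊔n (f zero) k
                    ; (suc i) → ℕₚ.≤-trans (f≤k i) (ℕₚ.m≤n⊔m (f zero) k) }

⌊⌋-true : ∀ {P : Set} (P? : Dec P) → P → ⌊ P? ⌋ ≡ true
⌊⌋-true (yes _) p = refl
⌊⌋-true (no ¬p) p = contradiction p ¬p

-- Total assignments, games and the finite model

module _ (S : Signature) where
  open Signature S
  open Structure

  Prefix Binding : Set
  Prefix  = List (Quant S × Var)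
  Binding = List (Args × Var)

  -- Semantics over total assignments; by `coincidence` the default values do not affect sentences.
  Sat : (R : Structure S) → (Args → D R) → (Var → D R) → Formula S → Set
  Sat R α ρ (rel r)      = Structure.rel R r α
  Sat R α ρ (neg φ)      = ¬ Sat R α ρ φ
  Sat R α ρ (and φ ψ)    = Sat R α ρ φ × Sat R α ρ ψ
  Sat R α ρ (or φ ψ)     = Sat R α ρ φ ⊎ Sat R α ρ ψ
  Sat R α ρ (ex x φ)     = ∃ λ d → Sat R α (update ℕ._≟_ ρ x d) φ
  Sat R α ρ (all x φ)    = ∀ d → Sat R α (update ℕ._≟_ ρ x d) φ
  Sat R α ρ (bind a x φ) = Sat R (update Fin._≟_ α a (ρ x)) ρ φ

  Sat₀ : Structure S → Formula S → Set
  Sat₀ R = Sat R (λ _ → D-inhab R) (λ _ → D-inhab R)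

  module _ {X : Set} {β : Var → Maybe X} {ρ : Var → X} where

    agree-quantifier : ∀ (free : Var → Bool) x d →
      (∀ y → free y ∧ not ⌊ y ℕ.≟ x ⌋ ≡ true → β y ≡ just (ρ y)) →
      ∀ y → free y ≡ true →
      (if ⌊ y ℕ.≟ x ⌋ then just d else β y) ≡ just (update ℕ._≟_ ρ x d y)
    agree-quantifier free x d agree y y-free with y ℕ.≟ x | agree y
    ... | yes _ | _   = refl
    ... | no  _ | agr = agr (trans (∧-identityʳ _) y-free)

    agree-bindVar : ∀ (freeV : Var → Bool) c x →
      (∀ y → (if c then freeV y ∨ ⌊ y ℕ.≟ x ⌋ else freeV y) ≡ true → β y ≡ just (ρ y)) →
      ∀ y → freeV y ≡ true → β y ≡ just (ρ y)
    agree-bindVar freeV true  x agree y y-free =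
      agree y (cong (_∨ ⌊ y ℕ.≟ x ⌋) y-free)
    agree-bindVar freeV false x agree y y-free = agree y y-free

    -- If `a` is free in the body, binding it makes `x` free, so `β x` is defined; otherwise `b`
    -- differs from `a`.
    agree-bindArg : ∀ {γ : Args → Maybe X} {α : Args → X}
      (freeA : Args → Bool) (freeV : Var → Bool) a x →
      (∀ b → (if freeA a then freeA b ∧ not ⌊ b Fin.≟ a ⌋ else freeA b) ≡ true →
             γ b ≡ just (α b)) →
      (∀ y → (if freeA a then freeV y ∨ ⌊ y ℕ.≟ x ⌋ else freeV y) ≡ true →
             β y ≡ just (ρ y)) →
      ∀ b → freeA b ≡ true →
      (if ⌊ b Fin.≟ a ⌋ then β x else γ b) ≡ just (update Fin._≟_ α a (ρ x) b)
    agree-bindArg freeA freeV a x agreeA agreeV b b-free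
      with b Fin.≟ a | freeA a in eq | agreeA b
    ... | yes refl | true  | _ = agreeV x
          (trans (cong (freeV x ∨_) (⌊⌋-true (x ℕ.≟ x) refl)) (∨-zeroʳ (freeV x)))
    ... | yes refl | false | _ = contradiction (trans (sym eq) b-free) λ ()
    ... | no  _    | true  | agr = agr (trans (∧-identityʳ _) b-free)
    ... | no  _    | false | agr = agr b-free

  coincidence : ∀ R φ χ α ρ →
    (∀ a → freeArg S φ a ≡ true → Assignment.onArgs χ a ≡ just (α a)) →
    (∀ x → freeVar S φ x ≡ true → Assignment.onVars χ x ≡ just (ρ x)) →
    (_,_⊨_ S R χ φ) ⇔ Sat R α ρ φ
  coincidence R (rel r) χ α ρ agreeA agreeV = mk⇔
    (λ (f , f-def , r-f) → rel-resp R r f α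
      (λ a a∈ → just-injective (trans (sym (f-def a a∈)) (defined a a∈))) r-f)
    (λ r-α → α , defined , r-α)
    where
    defined : ∀ a → a Subset.∈ ar r → Assignment.onArgs χ a ≡ just (α a)
    defined a a∈ = agreeA a (⌊⌋-true (a ∈? ar r) a∈)
  coincidence R (neg φ) χ α ρ agreeA agreeV =
    ¬-cong-⇔ (coincidence R φ χ α ρ agreeA agreeV)
  coincidence R (and φ ψ) χ α ρ agreeA agreeV =
    coincidence R φ χ α ρ (λ a → agreeA a ∘ cong (_∨ _)) (λ x → agreeV x ∘ cong (_∨ _))
    ×-⇔
    coincidence R ψ χ α ρ
      (λ a → agreeA a ∘ λ eq → trans (cong (_ ∨_) eq) (∨-zeroʳ _))
      (λ x → agreeV x ∘ λ eq → trans (cong (_ ∨_) eq) (∨-zeroʳ _))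
  coincidence R (or φ ψ) χ α ρ agreeA agreeV =
    coincidence R φ χ α ρ (λ a → agreeA a ∘ cong (_∨ _)) (λ x → agreeV x ∘ cong (_∨ _))
    ⊎-⇔
    coincidence R ψ χ α ρ
      (λ a → agreeA a ∘ λ eq → trans (cong (_ ∨_) eq) (∨-zeroʳ _))
      (λ x → agreeV x ∘ λ eq → trans (cong (_ ∨_) eq) (∨-zeroʳ _))
  coincidence R (ex x φ) χ α ρ agreeA agreeV = mk⇔
    (λ (d , p) → d , to (ih d) p) (λ (d , p) → d , from (ih d) p)
    where
    open Equivalence
    ih = λ d → coincidence R φ (setVar S χ x d) α (update ℕ._≟_ ρ x d) agreeA
                 (agree-quantifier (freeVar S φ) x d agreeV)
  coincidence R (all x φ) χ α ρ agreeA agreeV = mk⇔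
    (λ p d → to (ih d) (p d)) (λ p d → from (ih d) (p d))
    where
    open Equivalence
    ih = λ d → coincidence R φ (setVar S χ x d) α (update ℕ._≟_ ρ x d) agreeA
                 (agree-quantifier (freeVar S φ) x d agreeV)
  coincidence R (bind a x φ) χ α ρ agreeA agreeV =
    coincidence R φ (setArg S χ a x) (update Fin._≟_ α a (ρ x)) ρ
      (agree-bindArg (freeArg S φ) (freeVar S φ) a x agreeA agreeV)
      (agree-bindVar (freeVar S φ) (freeArg S φ a) x agreeV)

  IsModel⇔Sat₀ : ∀ R φ → Sentence S φ → IsModel S R φ ⇔ Sat₀ R φ
  IsModel⇔Sat₀ R φ (no-arg , no-var) = coincidence R φ (emptyAssignment S) _ _
    (λ a free → contradiction (trans (sym free) (no-arg a)) λ ())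
    (λ x free → contradiction (trans (sym free) (no-var x)) λ ())

  -- Tuples determined by the values of a prefix.

  assignVars : ∀ {X : Set} → Prefix → List X → (Var → X) → Var → X
  assignVars ((_ , x) ∷ w) (v ∷ vs) ρ = assignVars w vs (update ℕ._≟_ ρ x v)
  assignVars _             _        ρ = ρ

  assignArgs : ∀ {X : Set} → Binding → (Var → X) → (Args → X) → Args → X
  assignArgs []            ρ α = α
  assignArgs ((a , x) ∷ b) ρ α = assignArgs b ρ (update Fin._≟_ α a (ρ x))

  tuple : ∀ {X : Set} → X → Prefix → Binding → List X → Args → X
  tuple x₀ w b vs = assignArgs b (assignVars w vs (λ _ → x₀)) (λ _ → x₀)

  update-map : ∀ {I X Y : Set} (_≟_ : DecidableEquality I) (h : X → Y) {f g} →
    (∀ j → h (f j) ≡ g j) → ∀ {i x y} → h x ≡ y →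
    ∀ j → h (update _≟_ f i x j) ≡ update _≟_ g i y j
  update-map _≟_ h hf≡g {i} hx≡y j with j ≟ i
  ... | yes _ = hx≡y
  ... | no  _ = hf≡g j

  assignVars-map : ∀ {X Y : Set} (h : X → Y) w vs {ρ ρ′} → (∀ x → h (ρ x) ≡ ρ′ x) →
    ∀ x → h (assignVars w vs ρ x) ≡ assignVars w (List.map h vs) ρ′ x
  assignVars-map h []      vs       eq = eq
  assignVars-map h (_ ∷ w) []       eq = eq
  assignVars-map h (_ ∷ w) (v ∷ vs) eq =
    assignVars-map h w vs (update-map ℕ._≟_ h eq refl)

  assignArgs-map : ∀ {X Y : Set} (h : X → Y) b {ρ ρ′ α α′} →
    (∀ x → h (ρ x) ≡ ρ′ x) → (∀ a → h (α a) ≡ α′ a) →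
    ∀ a → h (assignArgs b ρ α a) ≡ assignArgs b ρ′ α′ a
  assignArgs-map h []            eqρ eqα = eqα
  assignArgs-map h ((_ , x) ∷ b) eqρ eqα =
    assignArgs-map h b eqρ (update-map Fin._≟_ h eqα (eqρ x))

  -- A tuple only copies entries of the list and the default, so every map respecting the default
  -- commutes with forming it.
  tuple-map : ∀ {X Y : Set} (h : X → Y) {x₀ y₀} → h x₀ ≡ y₀ → ∀ w b vs a →
    h (tuple x₀ w b vs a) ≡ tuple y₀ w b (List.map h vs) a
  tuple-map h eq w b vs =
    assignArgs-map h b (assignVars-map h w vs λ _ → eq) (λ _ → eq)

  Sat-applyB : ∀ R b {α ρ ψ} →
    Sat R α ρ (applyB S b ψ) ≡ Sat R (assignArgs b ρ α) ρ ψ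
  Sat-applyB R []      = refl
  Sat-applyB R (_ ∷ b) = Sat-applyB R b

  -- The atoms need equivalence rather than implication, since `dneg` reverses direction.
  Sat-derived : ∀ R M {A} (d : DerivedRel S A) {α ρ β ρ′} →
    (∀ r → ar r ≡ A → Structure.rel R r α ⇔ Structure.rel M r β) →
    Sat R α ρ (derived⇒F S d) ⇔ Sat M β ρ′ (derived⇒F S d)
  Sat-derived R M (atom r eq) same = same r eq
  Sat-derived R M (dneg d)    same = ¬-cong-⇔ (Sat-derived R M d same)
  Sat-derived R M (dand d e)  same = Sat-derived R M d same ×-⇔ Sat-derived R M e same
  Sat-derived R M (dor d e)   same = Sat-derived R M d same ⊎-⇔ Sat-derived R M e same

  -- A strategy maps the values chosen so far, for the existential and the
  -- universal variables alike, to the next existential value.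
  Strategy : Set → Set
  Strategy X = List X → X

  after : ∀ {X : Set} → Strategy X → X → Strategy X
  after σ v vs = σ (v ∷ vs)

  Play : ∀ {X : Set} → Prefix → Strategy X → List X → Set
  Play []             σ []       = ⊤
  Play ((∃q , _) ∷ w) σ (v ∷ vs) = v ≡ σ [] × Play w (after σ v) vs
  Play ((∀q , _) ∷ w) σ (v ∷ vs) = Play w (after σ v) vs
  Play _              _ _        = ⊥

  Winning : ∀ R → Strategy (D R) → (Args → D R) → (Var → D R) → Prefix → Formula S → Set
  Winning R σ α ρ w ψ = ∀ vs → Play w σ vs → Sat R α (assignVars w vs ρ) ψ

  skolemize : ∀ R {α ρ ψ} w → Sat R α ρ (applyQ S w ψ) → ∃ λ σ → Winning R σ α ρ w ψ
  skolemize R []             p       = (λ _ → D-inhab R) , λ { [] _ → p }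
  skolemize R ((∃q , _) ∷ w) (d , p) =
    let σ , win = skolemize R w p
    in (λ { [] → d ; (_ ∷ vs) → σ vs }) , λ { (_ ∷ vs) (refl , play) → win vs play }
  skolemize R ((∀q , _) ∷ w) p       =
    -- `Play` never consults a strategy at a universal position, so an arbitrary default stands
    -- there.
    (λ { [] → D-inhab R ; (v ∷ vs) → proj₁ (skolemize R w (p v)) vs }) ,
    λ { (v ∷ vs) play → proj₂ (skolemize R w (p v)) vs play }

  deskolemize : ∀ R {α ρ ψ} w σ → Winning R σ α ρ w ψ → Sat R α ρ (applyQ S w ψ)
  deskolemize R []             σ win = win [] tt
  deskolemize R ((∃q , _) ∷ w) σ win =
    σ [] , deskolemize R w (after σ (σ [])) λ vs play → win (_ ∷ vs) (refl , play)
  deskolemize R ((∀q , _) ∷ w) σ win v =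
    deskolemize R w (after σ v) λ vs → win (v ∷ vs)

  Play-length : ∀ {X : Set} w {σ : Strategy X} vs → Play w σ vs → length vs ≡ length w
  Play-length []             []       _          = refl
  Play-length ((∃q , _) ∷ w) (v ∷ vs) (_ , play) = cong suc (Play-length w vs play)
  Play-length ((∀q , _) ∷ w) (v ∷ vs) play       = cong suc (Play-length w vs play)

  -- Commutation is asked only at the proper initial segments of this one play, which is what
  -- `solution` can provide.
  Play-map : ∀ {X Y : Set} (h : X → Y) w {σ τ} vs →
    (∀ p → p < length vs → h (σ (List.take p vs)) ≡ τ (List.map h (List.take p vs))) →
    Play w σ vs → Play w τ (List.map h vs)
  Play-map h []             []       eq _             = tt
  Play-map h ((∃q , _) ∷ w) (v ∷ vs) eq (refl , play) =
    eq 0 (s≤s z≤n) , Play-map h w vs (λ p p< → eq (suc p) (s≤s p<)) play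
  Play-map h ((∀q , _) ∷ w) (v ∷ vs) eq play          =
    Play-map h w vs (λ p p< → eq (suc p) (s≤s p<)) play

  -- Conjuncts true in the given structure.

  record Clause (R : Structure S) : Set where
    field
      prefix   : Prefix
      binding  : Binding
      args     : Subset (suc nArgs)
      derived  : DerivedRel S args
      strategy : Strategy (D R)

    formula : Formula S
    formula = applyQ S prefix (applyB S binding (derived⇒F S derived))

    field
      winning : ∀ vs → Play prefix strategy vs →
        Sat R (tuple (D-inhab R) prefix binding vs)
              (assignVars prefix vs (λ _ → D-inhab R)) (derived⇒F S derived)

  -- Each disjunction keeps only the disjunct that the proof selects, so a pure conjunction remains.
  trueClauses : ∀ R φ → Sat₀ R (toFormula S φ) → List (Clause R)
  trueClauses R (basic (w , _) (b , _) _ d) p = record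
    { prefix   = w
    ; binding  = b
    ; derived  = d
    ; strategy = proj₁ (skolemize R w p)
    ; winning  = λ vs play → subst (λ P → P) (Sat-applyB R b) (proj₂ (skolemize R w p) vs play)
    } ∷ []
  trueClauses R (oand φ ψ) (p , q)  = trueClauses R φ p ++ trueClauses R ψ q
  trueClauses R (oor φ ψ)  (inj₁ p) = trueClauses R φ p
  trueClauses R (oor φ ψ)  (inj₂ q) = trueClauses R ψ q

  trueClauses-suffice : ∀ R φ (p : Sat₀ R (toFormula S φ)) M →
    All (Sat₀ M ∘ Clause.formula) (trueClauses R φ p) → Sat₀ M (toFormula S φ)
  trueClauses-suffice R (basic _ _ _ _) p M (c ∷ []) = c
  trueClauses-suffice R (oand φ ψ) (p , q) M cs =
    trueClauses-suffice R φ p M (++⁻ˡ (trueClauses R φ p) cs) ,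
    trueClauses-suffice R ψ q M (++⁻ʳ (trueClauses R φ p) cs)
  trueClauses-suffice R (oor φ ψ) (inj₁ p) M cs = inj₁ (trueClauses-suffice R φ p M cs)
  trueClauses-suffice R (oor φ ψ) (inj₂ q) M cs = inj₂ (trueClauses-suffice R ψ q M cs)

  -- The finite model.

  module FiniteModel (em : ExcludedMiddle 0ℓ) (R : Structure S) {m : ℕ}
                     (clause : Fin m → Clause R) where
    open Clause

    bound : ∃ λ k → ∀ i → length (prefix (clause i)) ≤ k
    bound = bounded (length ∘ prefix ∘ clause)

    K : ℕ
    -- One more than a bound on all prefix lengths: positions stay below `K`, where `mod K` is
    -- exact, and `K` is nonzero.
    K = suc (proj₁ bound)

    open Terms (m * K) K

    -- One function symbol for each clause i and position in its prefix, the
    -- position being the number of values chosen so far.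
    free-strategy : Fin m → Strategy Term
    free-strategy i vs = mk (Fin.combine i (length vs mod K)) (pad K star vs)

    -- A tuple is kept as a vector, constant outside A, so that without function
    -- extensionality it depends only on the values on A.
    view : Subset (suc nArgs) → (Args → Term) → Vec Term (suc nArgs)
    view A f = Vec.tabulate λ a → if ⌊ a ∈? A ⌋ then f a else star

    lookup-view : ∀ {A} f {a} → a Subset.∈ A → Vec.lookup (view A f) a ≡ f a
    lookup-view {A} f {a} a∈ = trans
      (Vecₚ.lookup∘tabulate (λ c → if ⌊ c ∈? A ⌋ then f c else star) a)
      (cong (λ c → if c then f a else star) (⌊⌋-true (a ∈? A) a∈))

    view-cong : ∀ {A f g} → (∀ a → a Subset.∈ A → f a ≡ g a) → view A f ≡ view A g
    view-cong {A} {f} {g} eq = Vecₚ.tabulate-cong same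
      where
      same : ∀ a → (if ⌊ a ∈? A ⌋ then f a else star) ≡ (if ⌊ a ∈? A ⌋ then g a else star)
      same a with a ∈? A
      ... | yes a∈ = eq a a∈
      ... | no  _  = refl

    term-tuple : Fin m → List Term → Args → Term
    term-tuple i = tuple star (prefix (clause i)) (binding (clause i))

    Realizes : Vec Term (suc nArgs) → Fin m → List Term → Set
    Realizes V i vs = Play (prefix (clause i)) (free-strategy i) vs ×
                      view (args (clause i)) (term-tuple i vs) ≡ V

    chosen : ∀ {V i} → Dec (∃ (Realizes V i)) → List Term
    chosen (yes (vs , _)) = vs
    chosen (no  _)        = []

    -- Excluded middle picks one play per clause yielding `V`; `[]` is the default if there is none.
    realizer : Vec Term (suc nArgs) → Fin m → List Term
    realizer V i = chosen {V} {i} em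

    realizer-realizes : ∀ {V i vs} → Realizes V i vs → Realizes V i (realizer V i)
    realizer-realizes {V} {i} realizes with em {∃ (Realizes V i)}
    ... | yes (_ , r) = r
    ... | no  none    = contradiction (_ , realizes) none

    -- `solution` allows one argument vector per symbol; the symbol `(i , p)` gets the first `p`
    -- values of the realizer of clause `i`.
    history : Vec Term (suc nArgs) → Fin m × Fin K → Vec Term K
    history V (i , p) = pad K star (List.take (toℕ p) (realizer V i))

    -- Discards the padding before consulting the strategy in `R`.
    respond : Fin m × Fin K → Vec (D R) K → D R
    respond (i , p) xs = strategy (clause i) (List.take (toℕ p) (toList xs))

    evaluation : ∀ V → ∃ λ (h : Term → D R) → h star ≡ D-inhab R ×
      (∀ t → h (mk t (history V (Fin.remQuot K t))) ≡
             respond (Fin.remQuot K t) (Vec.map h (history V (Fin.remQuot K t))))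
    evaluation V = solution (history V ∘ Fin.remQuot K) (D-inhab R) (respond ∘ Fin.remQuot K)

    -- Depends on `V` but not on a clause, so clauses sharing an atom agree on its truth at `V`.
    ⟦_⟧ : Vec Term (suc nArgs) → Term → D R
    ⟦ V ⟧ = proj₁ (evaluation V)

    ⟦⟧-star : ∀ V → ⟦ V ⟧ star ≡ D-inhab R
    ⟦⟧-star V = proj₁ (proj₂ (evaluation V))

    ⟦⟧-mk : ∀ V i p → ⟦ V ⟧ (mk (Fin.combine i p) (history V (i , p))) ≡
                      respond (i , p) (Vec.map ⟦ V ⟧ (history V (i , p)))
    ⟦⟧-mk V i p = subst (λ s → ⟦ V ⟧ (mk (Fin.combine i p) (history V s)) ≡
                               respond s (Vec.map ⟦ V ⟧ (history V s)))
      (Finₚ.remQuot-combine i p) (proj₂ (proj₂ (evaluation V)) (Fin.combine i p))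

    -- Along the realizer, the moves of `free-strategy` are the very applications fixed by
    -- `history`, and `take` undoes `pad`.
    ⟦⟧-strategy : ∀ V i → length (realizer V i) < K → ∀ p → p < length (realizer V i) →
      ⟦ V ⟧ (free-strategy i (List.take p (realizer V i))) ≡
      strategy (clause i) (List.map ⟦ V ⟧ (List.take p (realizer V i)))
    ⟦⟧-strategy V i len<K p p<len = begin
      ⟦ V ⟧ (mk (Fin.combine i (length us mod K)) (pad K star us))
        ≡⟨ cong (λ n → ⟦ V ⟧ (mk (Fin.combine i (n mod K)) (pad K star us))) length-us ⟩
      ⟦ V ⟧ (mk (Fin.combine i q) (pad K star us))
        ≡⟨ cong (λ n → ⟦ V ⟧ (mk (Fin.combine i q) (pad K star (List.take n vs)))) toℕ-q ⟨
      ⟦ V ⟧ (mk (Fin.combine i q) (history V (i , q)))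
        ≡⟨ ⟦⟧-mk V i q ⟩
      respond (i , q) (Vec.map ⟦ V ⟧ (history V (i , q)))
        ≡⟨ cong (λ n → strategy (clause i) (List.take n
             (toList (Vec.map ⟦ V ⟧ (pad K star (List.take n vs)))))) toℕ-q ⟩
      strategy (clause i) (List.take p (toList (Vec.map ⟦ V ⟧ (pad K star us))))
        ≡⟨ cong (strategy (clause i)) (begin
             List.take p (toList (Vec.map ⟦ V ⟧ (pad K star us)))
               ≡⟨ cong (List.take p) (Vecₚ.toList-map ⟦ V ⟧ (pad K star us)) ⟩
             List.take p (List.map ⟦ V ⟧ (toList (pad K star us)))
               ≡⟨ Listₚ.take-map p (toList (pad K star us)) ⟩
             List.map ⟦ V ⟧ (List.take p (toList (pad K star us)))
               ≡⟨ cong (λ n → List.map ⟦ V ⟧ (List.take n (toList (pad K star us)))) length-us ⟨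
             List.map ⟦ V ⟧ (List.take (length us) (toList (pad K star us)))
               ≡⟨ cong (List.map ⟦ V ⟧) (take-pad K star us us≤K) ⟩
             List.map ⟦ V ⟧ us ∎) ⟩
      strategy (clause i) (List.map ⟦ V ⟧ us) ∎
      where
      open ≡-Reasoning
      vs = realizer V i
      us = List.take p vs
      q  = p mod K
      p<K : p < K
      p<K = ℕₚ.<-trans p<len len<K
      length-us : length us ≡ p
      length-us = trans (Listₚ.length-take p vs) (ℕₚ.m≤n⇒m⊓n≡m (ℕₚ.<⇒≤ p<len))
      us≤K : length us ≤ K
      us≤K = subst (_≤ K) (sym length-us) (ℕₚ.<⇒≤ p<K)
      toℕ-q : toℕ q ≡ p
      toℕ-q = trans (Finₚ.toℕ-fromℕ< _) (m<n⇒m%n≡m p<K)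

    M : Structure S
    M = record
      { D        = Term
      ; D-inhab  = star
      ; rel      = λ r f → let V = view (ar r) f in Structure.rel R r (⟦ V ⟧ ∘ Vec.lookup V)
      ; rel-resp = λ r f g eq → subst
          (λ V → Structure.rel R r (⟦ V ⟧ ∘ Vec.lookup V)) (view-cong eq)
      }

    M-finite : Finite S M
    M-finite = Tree-finite _

    M-clause : ∀ i → Sat₀ M (formula (clause i))
    M-clause i = deskolemize M w (free-strategy i) λ vs play →
      subst (λ P → P) (sym (Sat-applyB M b)) (derived-holds vs play)
      where
      w = prefix (clause i)
      b = binding (clause i)
      A = args (clause i)
      derived-holds : ∀ vs → Play w (free-strategy i) vs →
        Sat M (term-tuple i vs) (assignVars w vs (λ _ → star)) (derived⇒F S (derived (clause i)))
      derived-holds vs play = Equivalence.to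
        (Sat-derived R M (derived (clause i)) same)
        -- The winning play in `R` is the image of `us`, not of `vs`: `⟦ V ⟧` is known to commute
        -- with the moves along `us`, and both plays yield the same tuple on `A`.
        (winning (clause i) (List.map ⟦ V ⟧ us)
          (Play-map ⟦ V ⟧ w us (⟦⟧-strategy V i us<K) us-play))
        where
        V = view A (term-tuple i vs)
        us = realizer V i
        us-realizes : Realizes V i us
        us-realizes = realizer-realizes (play , refl)
        us-play = proj₁ us-realizes
        us<K : length us < K
        us<K = s≤s (subst (_≤ proj₁ bound) (sym (Play-length w us us-play)) (proj₂ bound i))
        agree : ∀ a → a Subset.∈ A →
          tuple (D-inhab R) w b (List.map ⟦ V ⟧ us) a ≡ ⟦ V ⟧ (Vec.lookup V a)
        agree a a∈ = trans (sym (tuple-map ⟦ V ⟧ (⟦⟧-star V) w b us a))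
          (cong ⟦ V ⟧ (trans (sym (lookup-view (term-tuple i us) a∈))
            (cong (λ U → Vec.lookup U a) (proj₂ us-realizes))))
        same : ∀ r → ar r ≡ A →
          Structure.rel R r (tuple (D-inhab R) w b (List.map ⟦ V ⟧ us)) ⇔
          Structure.rel M r (term-tuple i vs)
        same r eq = subst
          (λ B → let U = view B (term-tuple i vs) in
                 Structure.rel R r (tuple (D-inhab R) w b (List.map ⟦ V ⟧ us)) ⇔
                 Structure.rel R r (⟦ U ⟧ ∘ Vec.lookup U))
          (sym eq)
          (mk⇔ (rel-resp R r _ _ λ a → agree a ∘ subst (a Subset.∈_) eq)
               (rel-resp R r _ _ λ a → sym ∘ agree a ∘ subst (a Subset.∈_) eq))

mainTheorem10 : ExcludedMiddle 0ℓ →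
    (S : Signature) (φ : OBFOL S) →
    Sentence S (toFormula S φ) →
    Satisfiable S (toFormula S φ) →
    HasFiniteModel S (toFormula S φ)
mainTheorem10 em S φ sentence (R , R⊨φ) =
  M , M-finite , Equivalence.from (IsModel⇔Sat₀ S M (toFormula S φ) sentence)
    (trueClauses-suffice S R φ p M
      (subst (All _) (Listₚ.tabulate-lookup clauses) (tabulate⁺ M-clause)))
  where
  p : Sat₀ S R (toFormula S φ)
  p = Equivalence.to (IsModel⇔Sat₀ S R (toFormula S φ) sentence) R⊨φ
  clauses = trueClauses S R φ p
  open FiniteModel S em R (List.lookup clauses)
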